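{- Let $n,m\ge1$ be integers and let $x_1,\ldots,x_n,z_1,\ldots,z_m$ be indeterminates. Then, as formal power series, $$\sum_{\pi\in\mathrm{PP}(\infty,n,m)}\ \prod_{(i,j)\in\mathrm{Des}(\pi)} x_i z_{\pi_{ij}}=\prod_{i=1}^{n}\prod_{\ell=1}^{m}\frac{1}{1-x_i z_\ell}.$$
   Context: A plane partition $\pi=(\pi_{ij})_{i,j\ge1}$ is a two-dimensional array of nonnegative integers with finitely many nonzero entries such that $\pi_{ij}\ge\pi_{i+1\,j}$ and $\pi_{ij}\ge\pi_{i\,j+1}$ for all $i,j\ge1$ ($i$ is the row index, $j$ the column index). $\mathrm{PP}(\infty,n,m)$ is the set of plane partitions with at most $n$ nonzero rows and all entries at most $m$ (the number of columns is not restricted). The descent set of $\pi$ is $\mathrm{Des}(\pi)=\{(i,j):\pi_{ij}>\pi_{i+1\,j}\}$. -}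

module Defs where

open import Algebra.Bundles.Raw using (RawMonoid)
import Algebra.Definitions.RawMonoid as RawMonoidDefinitions
open import Data.Empty using (⊥-elim)
open import Data.Fin.Base using (Fin; toℕ; fromℕ<; _↑ˡ_; _↑ʳ_)
open import Data.Integer.Base as ℤ using (ℤ; 0ℤ; 1ℤ)
import Data.Integer.Properties as ℤ
open import Data.Integer.Tactic.RingSolver using (solve-∀)
open import Data.List.Base as List using (List; []; _∷_; _++_; upTo; applyUpTo; cartesianProductWith)
import Data.List.Properties as List
open import Data.List.Membership.Setoid using () renaming (_∈_ to [_]_∈_)
open import Data.List.Membership.Propositional.Properties using (∈-applyUpTo⁻)
open import Data.List.Relation.Unary.All as All using (All; []; _∷_)
import Data.List.Relation.Unary.All.Properties as All
open import Data.List.Relation.Unary.Unique.Setoid using (Unique)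
open import Data.Nat.Base as ℕ using (ℕ; zero; suc; s≤s; s≤s⁻¹)
import Data.Nat.Properties as ℕ
open import Data.Product.Base using (Σ; ∃; _×_; _,_; proj₁; proj₂)
open import Data.Sum.Base using (_⊎_; inj₁; inj₂)
open import Data.Vec.Base as Vec using (Vec; []; _∷_; replicate; zipWith; _[_]≔_)
import Data.Vec.Properties as Vec
open import Function.Base using (_∘_)
open import Level using (0ℓ)
open import Relation.Binary.Bundles using (Setoid)
open import Relation.Binary.PropositionalEquality
open import Relation.Nullary.Decidable.Core using (Dec; yes; no)
open import Relation.Nullary.Negation.Core using (¬_)

Exponent : ℕ → Set
Exponent v = Vec ℕ v

degree : ∀ {v} → Exponent v → ℕ
degree = Vec.sum

_⊖_ : ∀ {v} → Exponent v → Exponent v → Exponent v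
_⊖_ = zipWith ℕ._∸_

𝟘 : ∀ {v} → Exponent v
𝟘 = replicate _ 0

-- The exponents a ≤ e (componentwise), so that (a , e ⊖ a) runs through
-- the ways of writing e as a sum of two exponents.
below : ∀ {v} → Exponent v → List (Exponent v)
below []      = [] ∷ []
below (k ∷ e) = cartesianProductWith _∷_ (upTo (suc k)) (below e)

sumℤ : List ℤ → ℤ
sumℤ = List.foldr ℤ._+_ 0ℤ

PowerSeries : ℕ → Set
PowerSeries v = Exponent v → ℤ

module _ {v : ℕ} where

  infix  4 _≈_
  infixl 6 _+_ _-_
  infixl 7 _*_
  infix  8 _⁻¹

  _≈_ : PowerSeries v → PowerSeries v → Set
  f ≈ g = ∀ e → f e ≡ g e

  monomial : Exponent v → PowerSeries v
  monomial a e with Vec.≡-dec ℕ._≟_ e a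
  ... | yes _ = 1ℤ
  ... | no  _ = 0ℤ

  0# 1# : PowerSeries v
  0# _ = 0ℤ
  1#   = monomial 𝟘

  var : Fin v → PowerSeries v
  var i = monomial (𝟘 [ i ]≔ 1)

  _+_ _-_ _*_ : PowerSeries v → PowerSeries v → PowerSeries v
  (f + g) e = f e ℤ.+ g e
  (f - g) e = f e ℤ.- g e
  (f * g) e = sumℤ (List.map (λ a → f a ℤ.* g (e ⊖ a)) (below e))

  *-rawMonoid : RawMonoid 0ℓ 0ℓ
  *-rawMonoid = record { Carrier = PowerSeries v ; _≈_ = _≈_ ; _∙_ = _*_ ; ε = 1# }

  ∏ : ∀ {k} → (Fin k → PowerSeries v) → PowerSeries v
  ∏ = RawMonoidDefinitions.sum *-rawMonoid

  -- geometric u k = 1 + u + ⋯ + uᵏ⁻¹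
  geometric : PowerSeries v → ℕ → PowerSeries v
  geometric u zero    = 0#
  geometric u (suc k) = 1# + u * geometric u k

  -- The multiplicative inverse of a series with constant coefficient 1,
  -- namely Σₖ (1 - f)ᵏ; only the terms with k ≤ degree e contribute to
  -- the coefficient at e.  For other f the value is meaningless.  See
  -- *-inverseʳ below.
  _⁻¹ : PowerSeries v → PowerSeries v
  (f ⁻¹) e = geometric (1# - f) (suc (degree e)) e

  -- s is the sum of the (possibly infinite) family F, in the topology of
  -- coefficientwise stabilisation: at every exponent only finitely many
  -- members of F have a nonzero coefficient, and these add up to the
  -- coefficient of s.  The list may contain further indices, whose
  -- coefficients are zero.
  HasSum : (I : Setoid 0ℓ 0ℓ) → (Setoid.Carrier I → PowerSeries v) → PowerSeries v → Set
  HasSum I F s = ∀ e → Σ (List (Setoid.Carrier I)) λ is →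
    Unique I is ×
    (∀ i → F i e ≢ 0ℤ → [ I ] i ∈ is) ×
    sumℤ (List.map (λ i → F i e) is) ≡ s e

private

  ⊖-identityʳ : ∀ {v} (e : Exponent v) → e ⊖ 𝟘 ≡ e
  ⊖-identityʳ []      = refl
  ⊖-identityʳ (k ∷ e) = cong (k ∷_) (⊖-identityʳ e)

  degree-⊖ : ∀ {v} (e a : Exponent v) → degree (e ⊖ a) ℕ.≤ degree e
  degree-⊖ []      []      = ℕ.z≤n
  degree-⊖ (k ∷ e) (l ∷ a) = ℕ.+-mono-≤ (ℕ.m∸n≤m k l) (degree-⊖ e a)

  Smaller : ∀ {v} → Exponent v → Exponent v → Set
  Smaller e a = a ≢ 𝟘 × degree (e ⊖ a) ℕ.< degree e

  below-split : ∀ {v} (e : Exponent v) → ∃ λ as → below e ≡ 𝟘 ∷ as × All (Smaller e) as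
  below-split []      = [] , refl , []
  below-split (k ∷ e) with below-split e
  ... | as , eq , smaller =
    List.map (0 ∷_) as ++ rest ,
    cong (λ bs → List.map (0 ∷_) bs ++ rest) eq ,
    All.++⁺ (All.map⁺ (All.map small₀ smaller))
            (All.cartesianProductWith⁺ (setoid ℕ) (setoid (Exponent _)) _∷_ (applyUpTo suc k) (below e)
              λ l∈ _ → small₊ (∈-applyUpTo⁻ suc l∈))
    where
    rest = cartesianProductWith _∷_ (applyUpTo suc k) (below e)

    small₀ : ∀ {a} → Smaller e a → Smaller (k ∷ e) (0 ∷ a)
    small₀ (a≢𝟘 , lt) = a≢𝟘 ∘ Vec.∷-injectiveʳ , ℕ.+-monoʳ-< k lt

    small₊ : ∀ {l a} → (∃ λ i → i ℕ.< k × l ≡ suc i) → Smaller (k ∷ e) (l ∷ a)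
    small₊ {a = a} (i , i<k , refl) =
      (λ ()) ,
      ℕ.+-mono-<-≤ (ℕ.∸-monoʳ-< {k} {suc i} {0} (s≤s ℕ.z≤n) i<k) (degree-⊖ e a)

  sum-cong : ∀ {A : Set} {f g : A → ℤ} {as} → All (λ a → f a ≡ g a) as →
             sumℤ (List.map f as) ≡ sumℤ (List.map g as)
  sum-cong = cong sumℤ ∘ List.map-cong-local

  sum-zero : ∀ {A : Set} {f : A → ℤ} {as} → All (λ a → f a ≡ 0ℤ) as →
             sumℤ (List.map f as) ≡ 0ℤ
  sum-zero []       = refl
  sum-zero (p ∷ ps) = cong₂ ℤ._+_ p (sum-zero ps)

  sum-minus : ∀ {A : Set} (f g : A → ℤ) as →
              sumℤ (List.map (λ a → f a ℤ.- g a) as) ≡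
              sumℤ (List.map f as) ℤ.- sumℤ (List.map g as)
  sum-minus f g []       = refl
  sum-minus f g (a ∷ as) =
    trans (cong (λ t → f a ℤ.- g a ℤ.+ t) (sum-minus f g as))
          (rearrange (f a) (g a) (sumℤ (List.map f as)) (sumℤ (List.map g as)))
    where
    rearrange : ∀ p q r s → p ℤ.- q ℤ.+ (r ℤ.- s) ≡ p ℤ.+ r ℤ.- (q ℤ.+ s)
    rearrange = solve-∀

  1#-𝟘 : ∀ {v} → 1# {v} 𝟘 ≡ 1ℤ
  1#-𝟘 {v} with Vec.≡-dec ℕ._≟_ (𝟘 {v}) 𝟘
  ... | yes _  = refl
  ... | no ¬eq = ⊥-elim (¬eq refl)

  1#-≢𝟘 : ∀ {v} {a : Exponent v} → a ≢ 𝟘 → 1# a ≡ 0ℤ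
  1#-≢𝟘 {a = a} a≢𝟘 with Vec.≡-dec ℕ._≟_ a 𝟘
  ... | yes eq = ⊥-elim (a≢𝟘 eq)
  ... | no _   = refl

  *-identityˡ : ∀ {v} (g : PowerSeries v) → 1# * g ≈ g
  *-identityˡ g e with below-split e
  ... | as , eq , smaller rewrite eq | 1#-𝟘 {Vec.length e} = trans
    (cong₂ ℤ._+_ (trans (ℤ.*-identityˡ _) (cong g (⊖-identityʳ e)))
                 (sum-zero (All.map (λ {a} s → cong (ℤ._* g (e ⊖ a)) (1#-≢𝟘 (proj₁ s))) smaller)))
    (ℤ.+-identityʳ (g e))

  geometric-step : ∀ {v} (u : PowerSeries v) → u 𝟘 ≡ 0ℤ → ∀ k e → degree e ℕ.< k →
                   geometric u (suc k) e ≡ geometric u k e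
  geometric-step u u₀ (suc k) e lt = cong (ℤ._+_ (1# e)) (step (below-split e))
    where
    step : (∃ λ as → below e ≡ 𝟘 ∷ as × All (Smaller e) as) →
           (u * geometric u (suc k)) e ≡ (u * geometric u k) e
    step (as , eq , smaller) rewrite eq | u₀ = cong (ℤ._+_ 0ℤ) (sum-cong (All.map
      (λ {a} s → cong (u a ℤ.*_)
        (geometric-step u u₀ k (e ⊖ a) (ℕ.<-≤-trans (proj₂ s) (s≤s⁻¹ lt)))) smaller))

  geometric-stable : ∀ {v} (u : PowerSeries v) → u 𝟘 ≡ 0ℤ → ∀ {k l} e → degree e ℕ.< k →
                     k ℕ.≤′ l → geometric u k e ≡ geometric u l e
  geometric-stable u u₀ e lt (ℕ.≤′-reflexive refl) = refl
  geometric-stable u u₀ e lt (ℕ.≤′-step {l} k≤l)   =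
    trans (geometric-stable u u₀ e lt k≤l)
          (sym (geometric-step u u₀ l e (ℕ.<-≤-trans lt (ℕ.≤′⇒≤ k≤l))))

*-inverseʳ : ∀ {v} (f : PowerSeries v) → f 𝟘 ≡ 1ℤ → f * f ⁻¹ ≈ 1#
*-inverseʳ {v} f f₀ e = begin
  (f * f ⁻¹) e
    ≡⟨ sum-cong (All.universal pointwise (below e)) ⟩
  sumℤ (List.map (λ a → 1# a ℤ.* g (e ⊖ a) ℤ.- u a ℤ.* g (e ⊖ a)) (below e))
    ≡⟨ sum-minus _ _ (below e) ⟩
  (1# * g) e ℤ.- (u * g) e
    ≡⟨ cong (ℤ._- (u * g) e) (trans (*-identityˡ g e) (sym (geometric-step u u₀ K e ℕ.≤-refl))) ⟩
  1# e ℤ.+ (u * g) e ℤ.- (u * g) e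
    ≡⟨ cancel (1# e) ((u * g) e) ⟩
  1# e ∎
  where
  open ≡-Reasoning
  K = suc (degree e)
  u = 1# - f
  g = geometric u K

  u₀ : u 𝟘 ≡ 0ℤ
  u₀ = cong₂ ℤ._-_ (1#-𝟘 {v}) f₀

  cancel : ∀ p q → p ℤ.+ q ℤ.- q ≡ p
  cancel = solve-∀

  expand : ∀ o p q → p ℤ.* q ≡ o ℤ.* q ℤ.- (o ℤ.- p) ℤ.* q
  expand = solve-∀

  pointwise : ∀ a → f a ℤ.* (f ⁻¹) (e ⊖ a) ≡ 1# a ℤ.* g (e ⊖ a) ℤ.- u a ℤ.* g (e ⊖ a)
  pointwise a = trans
    (cong (f a ℤ.*_) (geometric-stable u u₀ (e ⊖ a) ℕ.≤-refl (ℕ.≤⇒≤′ (s≤s (degree-⊖ e a)))))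
    (expand (1# a) (f a) (g (e ⊖ a)))

-- Rows and columns are numbered from 0.
record PlanePartition : Set where
  field
    entry       : ℕ → ℕ → ℕ
    column-decr : ∀ i j → entry (suc i) j ℕ.≤ entry i j
    row-decr    : ∀ i j → entry i (suc j) ℕ.≤ entry i j
    -- Finite support, as a square outside which all entries vanish.
    bound       : ℕ
    outside     : ∀ i j → bound ℕ.≤ i ⊎ bound ℕ.≤ j → entry i j ≡ 0

  Des : ℕ × ℕ → Set
  Des (i , j) = entry i j ℕ.> entry (suc i) j

  Des? : ∀ i j → Dec (Des (i , j))
  Des? i j = entry (suc i) j ℕ.<? entry i j

-- At most n nonzero rows (these are the first ones, since columns
-- decrease), and entries at most m.
record PP∞ (n m : ℕ) : Set where
  field
    planePartition : PlanePartition
  open PlanePartition planePartition public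
  field
    rows≤    : ∀ i j → n ℕ.≤ i → entry i j ≡ 0
    entries≤ : ∀ i j → entry i j ℕ.≤ m

  Des⇒row< : ∀ {i j} → Des (i , j) → i ℕ.< n
  Des⇒row< {i} {j} d = ℕ.≰⇒> λ n≤i → ℕ.n≮0 (subst (entry (suc i) j ℕ.<_) (rows≤ i j n≤i) d)

  Des⇒column< : ∀ {i j} → Des (i , j) → j ℕ.< bound
  Des⇒column< {i} {j} d = ℕ.≰⇒> λ b≤j → ℕ.n≮0 (subst (entry (suc i) j ℕ.<_) (outside i j (inj₂ b≤j)) d)

-- Only the arrays are compared: bound is not determined by the array,
-- and must not make one plane partition count several times.
PP∞-setoid : ℕ → ℕ → Setoid 0ℓ 0ℓ
PP∞-setoid n m = record
  { Carrier       = PP∞ n m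
  ; _≈_           = λ π ρ → ∀ i j → PP∞.entry π i j ≡ PP∞.entry ρ i j
  ; isEquivalence = record
    { refl  = λ _ _ → refl
    ; sym   = λ p i j → sym (p i j)
    ; trans = λ p q i j → trans (p i j) (q i j)
    }
  }

-- The indeterminates x₁,…,xₙ, z₁,…,zₘ, numbered from 0 by Fin.
module _ {n m : ℕ} where

  x : Fin n → PowerSeries (n ℕ.+ m)
  x i = var (i ↑ˡ m)

  z : Fin m → PowerSeries (n ℕ.+ m)
  z ℓ = var (n ↑ʳ ℓ)

-- The position in z₁,…,zₘ of z with the (1-based) subscript k.
subscript : ∀ {m k b} → b ℕ.< k → k ℕ.≤ m → Fin m
subscript {k = suc _} _ k≤m = fromℕ< k≤m

module _ {n m : ℕ} (π : PP∞ n m) where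
  open PP∞ π

  factor : ∀ i j → Dec (Des (toℕ i , j)) → PowerSeries (n ℕ.+ m)
  factor i j (yes d) = x {n} {m} i * z {n} {m} (subscript d (entries≤ (toℕ i) j))
  factor i j (no _)  = 1#

  -- The product over Des; by Des⇒row< and Des⇒column< every descent lies
  -- in the first n rows and the first bound columns.
  descentProduct : PowerSeries (n ℕ.+ m)
  descentProduct = ∏ λ (i : Fin n) → ∏ λ (j : Fin bound) →
    factor i (toℕ j) (Des? (toℕ i) (toℕ j))

{-# OPTIONS --safe #-}

-- Encode π by the numbers G i ℓ of columns j with π i j > ℓ.  The descents in
-- row i with π i j = ℓ + 1 are the columns j from G i (ℓ + 1) ⊔ G (i + 1) ℓ up
-- to G i ℓ.  If d i ℓ is their number, then π has weight ∏ (x i * z ℓ) ^ d i ℓ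
-- (with 0-based ℓ), and
--     G i ℓ = d i ℓ + (G i (ℓ + 1) ⊔ G (i + 1) ℓ).
-- This last passage recursion determines G from an arbitrary n × m matrix d of
-- natural numbers, so that π ↦ d is a bijection onto the matrices, which also
-- index the terms of the expanded product of geometric series.

module Submission where

open import Algebra.Bundles using (CommutativeMonoid)
import Algebra.Properties.CommutativeMonoid.Sum as CommutativeMonoidSum
open import Data.Bool.Base using (if_then_else_)
open import Data.Fin.Base as Fin using (Fin; toℕ; _↑ˡ_; _↑ʳ_)
import Data.Fin.Properties as Fin
open import Data.Integer.Base as ℤ using (ℤ; 0ℤ; 1ℤ)
import Data.Integer.Properties as ℤ
open import Data.Integer.Tactic.RingSolver using (solve-∀)
open import Data.List.Base as List using (List; []; _∷_; _∷ʳ_; _++_; upTo; applyUpTo; cartesianProductWith)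
import Data.List.Properties as List
open import Data.List.Membership.Propositional using (_∈_)
open import Data.List.Membership.Setoid using () renaming (_∈_ to [_]_∈_)
open import Data.List.Membership.Propositional.Properties
  using (∈-cartesianProductWith⁺; ∈-cartesianProductWith⁻; ∈-upTo⁺; ∈-upTo⁻)
import Data.List.Membership.Setoid.Properties as SetoidMembership
open import Data.List.Relation.Unary.All as All using ([]; _∷_)
open import Data.List.Relation.Unary.AllPairs using ([]; _∷_)
open import Data.List.Relation.Unary.Any using (here; there)
open import Data.List.Relation.Unary.Unique.Propositional using (Unique)
import Data.List.Relation.Unary.Unique.Propositional.Properties as Unique
import Data.List.Relation.Unary.Unique.Setoid.Properties as SetoidUnique
open import Data.Nat.Base as ℕ using (ℕ; zero; suc; s≤s; z≤n; _≤_; _<_; _≥_; _⊔_; _∸_)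
import Data.Nat.Properties as ℕ
open import Data.Product.Base using (∃; _×_; _,_; proj₁; proj₂)
open import Data.Sum.Base using (_⊎_; inj₁; inj₂)
open import Data.Vec.Base as Vec using (Vec; []; _∷_; zipWith; lookup; _[_]≔_)
import Data.Vec.Properties as Vec
open import Function.Base using (_∘_)
open import Function.Bundles using (_⇔_; mk⇔; Equivalence)
open import Level using (0ℓ)
open import Relation.Binary.Bundles using (Setoid)
open import Relation.Binary.PropositionalEquality hiding ([_])
open import Relation.Nullary.Decidable using (yes; no; does; dec-true; dec-false)
open import Relation.Nullary.Negation.Core using (¬_; contradiction)

open import Defs

-- Exponents

infixl 6 _⊕_

_⊕_ : ∀ {v} → Exponent v → Exponent v → Exponent v
_⊕_ = zipWith ℕ._+_

⊕-commutativeMonoid : ℕ → CommutativeMonoid 0ℓ 0ℓ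
⊕-commutativeMonoid v = record
  { Carrier             = Exponent v
  ; _≈_                 = _≡_
  ; _∙_                 = _⊕_
  ; ε                   = 𝟘
  ; isCommutativeMonoid = record
    { isMonoid = record
      { isSemigroup = record
        { isMagma = isMagma _⊕_
        ; assoc   = Vec.zipWith-assoc ℕ.+-assoc
        }
      ; identity = Vec.zipWith-identityˡ ℕ.+-identityˡ , Vec.zipWith-identityʳ ℕ.+-identityʳ
      }
    ; comm = Vec.zipWith-comm ℕ.+-comm
    }
  }
  where open import Relation.Binary.PropositionalEquality.Algebra using (isMagma)

module _ {v : ℕ} where
  open CommutativeMonoidSum (⊕-commutativeMonoid v) public
    using (∑-comm) renaming (sum to ∑; sum-cong-≗ to ∑-cong)
  open import Algebra.Definitions.RawMonoid (CommutativeMonoid.rawMonoid (⊕-commutativeMonoid v)) public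
    using () renaming (_×_ to _·_)

⊕-identityˡ : ∀ {v} (a : Exponent v) → 𝟘 ⊕ a ≡ a
⊕-identityˡ = CommutativeMonoid.identityˡ (⊕-commutativeMonoid _)

⊕-identityʳ : ∀ {v} (a : Exponent v) → a ⊕ 𝟘 ≡ a
⊕-identityʳ = CommutativeMonoid.identityʳ (⊕-commutativeMonoid _)

∑-zero : ∀ {v k} {t : Fin k → Exponent v} → (∀ i → t i ≡ 𝟘) → ∑ t ≡ 𝟘
∑-zero {k = zero}  p = refl
∑-zero {k = suc k} p = trans (cong₂ _⊕_ (p Fin.zero) (∑-zero (p ∘ Fin.suc))) (⊕-identityˡ 𝟘)

∑-single : ∀ {v k} {t : Fin k → Exponent v} i → (∀ j → j ≢ i → t j ≡ 𝟘) → ∑ t ≡ t i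
∑-single Fin.zero p =
  trans (cong (_ ⊕_) (∑-zero λ j → p (Fin.suc j) λ ())) (⊕-identityʳ _)
∑-single (Fin.suc i) p =
  trans (cong₂ _⊕_ (p Fin.zero λ ()) (∑-single i λ j j≢i → p (Fin.suc j) (j≢i ∘ Fin.suc-injective)))
        (⊕-identityˡ _)

degree-⊕ : ∀ {v} (a b : Exponent v) → degree (a ⊕ b) ≡ degree a ℕ.+ degree b
degree-⊕ []      []      = refl
degree-⊕ (k ∷ a) (l ∷ b) =
  trans (cong (k ℕ.+ l ℕ.+_) (degree-⊕ a b)) (interchange k l (degree a) (degree b))
  where open import Algebra.Properties.CommutativeSemigroup ℕ.+-commutativeSemigroup using (interchange)

degree-⊕ˡ : ∀ {v} (a b : Exponent v) → degree a ≤ degree (a ⊕ b)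
degree-⊕ˡ a b rewrite degree-⊕ a b = ℕ.m≤m+n _ _

degree-⊕ʳ : ∀ {v} (a b : Exponent v) → degree b ≤ degree (a ⊕ b)
degree-⊕ʳ a b rewrite degree-⊕ a b = ℕ.m≤n+m _ _

degree-∑ : ∀ {v k} (t : Fin k → Exponent v) i → degree (t i) ≤ degree (∑ t)
degree-∑ t Fin.zero    = degree-⊕ˡ (t Fin.zero) _
degree-∑ t (Fin.suc i) = ℕ.≤-trans (degree-∑ (t ∘ Fin.suc) i) (degree-⊕ʳ (t Fin.zero) _)

-- Bounds a multiplicity by the degree of the resulting power, so that only finitely many powers of
-- a nonconstant monomial can reach a given coefficient.
degree-· : ∀ {v} {a : Exponent v} → 1 ≤ degree a → ∀ k → k ≤ degree (k · a)
degree-· {a = a} 1≤a zero    = z≤n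
degree-· {a = a} 1≤a (suc k) rewrite degree-⊕ a (k · a) = ℕ.+-mono-≤ 1≤a (degree-· 1≤a k)

degree-unit : ∀ {v} (i : Fin v) → 1 ≤ degree (𝟘 [ i ]≔ 1)
degree-unit Fin.zero    = s≤s z≤n
degree-unit (Fin.suc i) = degree-unit i

below-unique : ∀ {v} (e : Exponent v) → Unique (below e)
below-unique []      = [] ∷ []
below-unique (k ∷ e) = Unique.cartesianProductWith⁺ _∷_ Vec.∷-injective (Unique.upTo⁺ (suc k)) (below-unique e)

∈-below⁺ : ∀ {v} (a b : Exponent v) → a ∈ below (a ⊕ b)
∈-below⁺ []      []      = here refl
∈-below⁺ (k ∷ a) (l ∷ b) =
  ∈-cartesianProductWith⁺ _∷_ (∈-upTo⁺ (s≤s (ℕ.m≤m+n k l))) (∈-below⁺ a b)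

∈-below⁻ : ∀ {v} (e : Exponent v) {a} → a ∈ below e → a ⊕ (e ⊖ a) ≡ e
∈-below⁻ []      (here refl) = refl
∈-below⁻ (k ∷ e) a∈ with ∈-cartesianProductWith⁻ _∷_ (upTo (suc k)) (below e) a∈
... | _ , _ , l∈ , b∈ , refl = cong₂ _∷_ (ℕ.m+[n∸m]≡n (ℕ.s≤s⁻¹ (∈-upTo⁻ l∈))) (∈-below⁻ e b∈)

[a⊕b]⊖a≡b : ∀ {v} (a b : Exponent v) → (a ⊕ b) ⊖ a ≡ b
[a⊕b]⊖a≡b []      []      = refl
[a⊕b]⊖a≡b (k ∷ a) (l ∷ b) = cong₂ _∷_ (ℕ.m+n∸m≡n k l) ([a⊕b]⊖a≡b a b)

-- Sums of monomials

module _ {A : Set} where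

  sum-cong : ∀ {f g : A → ℤ} as → (∀ {a} → a ∈ as → f a ≡ g a) →
             sumℤ (List.map f as) ≡ sumℤ (List.map g as)
  sum-cong as p = cong sumℤ (List.map-cong-local (All.tabulate p))

  sum-zero : ∀ {f : A → ℤ} as → (∀ {a} → a ∈ as → f a ≡ 0ℤ) → sumℤ (List.map f as) ≡ 0ℤ
  sum-zero []       p = refl
  sum-zero (a ∷ as) p = cong₂ ℤ._+_ (p (here refl)) (sum-zero as (p ∘ there))

  sum-single : ∀ {f : A → ℤ} {a as} → Unique as → a ∈ as → (∀ c → c ≢ a → f c ≡ 0ℤ) →
               sumℤ (List.map f as) ≡ f a
  sum-single {f} {a} {_ ∷ as} (a∉ ∷ _) (here refl) p =
    trans (cong (ℤ._+_ (f a)) (sum-zero as λ c∈ → p _ (≢-sym (All.lookup a∉ c∈)))) (ℤ.+-identityʳ (f a))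
  sum-single (c∉ ∷ as!) (there a∈) p =
    trans (cong₂ ℤ._+_ (p _ (All.lookup c∉ a∈)) (sum-single as! a∈ p)) (ℤ.+-identityˡ _)

  sum-+ : ∀ (f g : A → ℤ) as → sumℤ (List.map (λ a → f a ℤ.+ g a) as) ≡
          sumℤ (List.map f as) ℤ.+ sumℤ (List.map g as)
  sum-+ f g []       = refl
  sum-+ f g (a ∷ as) = trans (cong (λ t → f a ℤ.+ g a ℤ.+ t) (sum-+ f g as))
                             (interchange (f a) (g a) _ _)
    where
    interchange : ∀ p q r s → p ℤ.+ q ℤ.+ (r ℤ.+ s) ≡ p ℤ.+ r ℤ.+ (q ℤ.+ s)
    interchange = solve-∀

sum-++ : ∀ ks ls → sumℤ (ks ++ ls) ≡ sumℤ ks ℤ.+ sumℤ ls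
sum-++ []       ls = sym (ℤ.+-identityˡ _)
sum-++ (k ∷ ks) ls = trans (cong (ℤ._+_ k) (sum-++ ks ls)) (sym (ℤ.+-assoc k _ _))

module _ {v : ℕ} where

  -- Matrices with entries at most K exhaust a product of geometric series only up to degree K.
  infix 4 _≈[_]_

  _≈[_]_ : PowerSeries v → ℕ → PowerSeries v → Set
  f ≈[ K ] g = ∀ e → degree e ≤ K → f e ≡ g e

  -- The coefficient of a product at `e` involves only summands of `e`, whose degrees do not exceed
  -- that of `e`; agreement up to degree `K` is therefore passed on.
  *-cong : ∀ {K} {f f′ g g′ : PowerSeries v} → f ≈[ K ] f′ → g ≈[ K ] g′ → f * g ≈[ K ] f′ * g′
  *-cong p q e e≤K = sum-cong (below e) λ {a} a∈ → let a⊕b≡e = cong degree (∈-below⁻ e a∈) in cong₂ ℤ._*_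
    (p a       (ℕ.≤-trans (ℕ.≤-trans (degree-⊕ˡ a (e ⊖ a)) (ℕ.≤-reflexive a⊕b≡e)) e≤K))
    (q (e ⊖ a) (ℕ.≤-trans (ℕ.≤-trans (degree-⊕ʳ a (e ⊖ a)) (ℕ.≤-reflexive a⊕b≡e)) e≤K))

  *-distribʳ-+ : ∀ (f g h : PowerSeries v) → (f + g) * h ≈ f * h + g * h
  *-distribʳ-+ f g h e = trans
    (sum-cong (below e) λ {a} _ → ℤ.*-distribʳ-+ (h (e ⊖ a)) (f a) (g a))
    (sum-+ _ _ (below e))

  *-distribˡ-+ : ∀ (f g h : PowerSeries v) → f * (g + h) ≈ f * g + f * h
  *-distribˡ-+ f g h e = trans
    (sum-cong (below e) λ {a} _ → ℤ.*-distribˡ-+ (f a) (g (e ⊖ a)) (h (e ⊖ a)))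
    (sum-+ _ _ (below e))

  *-zeroˡ : ∀ (f : PowerSeries v) → 0# * f ≈ 0#
  *-zeroˡ f e = sum-zero (below e) λ {a} _ → ℤ.*-zeroˡ (f (e ⊖ a))

  *-zeroʳ : ∀ (f : PowerSeries v) → f * 0# ≈ 0#
  *-zeroʳ f e = sum-zero (below e) λ {a} _ → ℤ.*-zeroʳ (f a)

  monomial-≡ : ∀ (a : Exponent v) → monomial a a ≡ 1ℤ
  monomial-≡ a with Vec.≡-dec ℕ._≟_ a a
  ... | yes _   = refl
  ... | no  a≢a = contradiction refl a≢a

  monomial-≢ : ∀ {a e : Exponent v} → e ≢ a → monomial a e ≡ 0ℤ
  monomial-≢ {a} {e} e≢a with Vec.≡-dec ℕ._≟_ e a
  ... | yes e≡a = contradiction e≡a e≢a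
  ... | no  _   = refl

  monomial-support : ∀ {a e : Exponent v} → monomial a e ≢ 0ℤ → e ≡ a
  monomial-support {a} {e} ≢0 with Vec.≡-dec ℕ._≟_ e a
  ... | yes e≡a = e≡a
  ... | no  _   = contradiction refl ≢0

  -- In the convolution only the splitting with left part `a` can survive, and its right part is `b`
  -- just when `e` is `a ⊕ b`.
  monomial-* : ∀ (a b : Exponent v) → monomial a * monomial b ≈ monomial (a ⊕ b)
  monomial-* a b e with Vec.≡-dec ℕ._≟_ e (a ⊕ b)
  ... | yes refl = begin
    (monomial a * monomial b) (a ⊕ b)
      ≡⟨ sum-single (below-unique (a ⊕ b)) (∈-below⁺ a b)
           (λ c c≢a → cong (ℤ._* monomial b ((a ⊕ b) ⊖ c)) (monomial-≢ c≢a)) ⟩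
    monomial a a ℤ.* monomial b ((a ⊕ b) ⊖ a)
      ≡⟨ cong₂ ℤ._*_ (monomial-≡ a) (cong (monomial b) ([a⊕b]⊖a≡b a b)) ⟩
    1ℤ ℤ.* monomial b b
      ≡⟨ cong (1ℤ ℤ.*_) (monomial-≡ b) ⟩
    1ℤ ∎
    where open ≡-Reasoning
  ... | no e≢ = sum-zero (below e) vanish
    where
    vanish : ∀ {c} → c ∈ below e → monomial a c ℤ.* monomial b (e ⊖ c) ≡ 0ℤ
    vanish {c} c∈ with Vec.≡-dec ℕ._≟_ c a
    ... | no  _    = refl
    ... | yes refl = cong (1ℤ ℤ.*_) (monomial-≢ λ e⊖a≡b → e≢ (trans (sym (∈-below⁻ e c∈)) (cong (a ⊕_) e⊖a≡b)))

  ∏-monomial : ∀ {k} {f : Fin k → PowerSeries v} {t} → (∀ i → f i ≈ monomial (t i)) →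
               ∏ f ≈ monomial (∑ t)
  ∏-monomial {zero}  p e = refl
  ∏-monomial {suc k} {f} {t} p e = trans
    -- The truncated congruence, used at one exponent at a time with its own degree as cutoff, gives
    -- the untruncated one.
    (*-cong {degree e} (λ a _ → p Fin.zero a) (λ a _ → ∏-monomial (p ∘ Fin.suc) a) e ℕ.≤-refl)
    (monomial-* (t Fin.zero) _ e)

  -- The coefficient at `e` counts the listed indices that `p` sends to `e`. Indices are listed
  -- rather than exponents because different matrices may have the same weight.
  polynomial : ∀ {A : Set} → (A → Exponent v) → List A → PowerSeries v
  polynomial p as e = sumℤ (List.map (λ a → monomial (p a) e) as)

  polynomial-++ : ∀ {A : Set} (p : A → Exponent v) as bs →
                  polynomial p (as ++ bs) ≈ polynomial p as + polynomial p bs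
  polynomial-++ p as bs e = trans (cong sumℤ (List.map-++ _ as bs)) (sum-++ (List.map _ as) _)

  polynomial-map : ∀ {A B : Set} (p : B → Exponent v) (f : A → B) as →
                   polynomial p (List.map f as) ≈ polynomial (p ∘ f) as
  polynomial-map p f as e = cong sumℤ (sym (List.map-∘ as))

  monomial-*-polynomial : ∀ {A : Set} a (p : A → Exponent v) as →
                          monomial a * polynomial p as ≈ polynomial (λ c → a ⊕ p c) as
  monomial-*-polynomial a p []       e = *-zeroʳ (monomial a) e
  monomial-*-polynomial a p (c ∷ as) e = trans
    (*-distribˡ-+ (monomial a) (monomial (p c)) (polynomial p as) e)
    (cong₂ ℤ._+_ (monomial-* a (p c) e) (monomial-*-polynomial a p as e))

  polynomial-* : ∀ {A B C : Set} (p : A → Exponent v) (q : B → Exponent v) (r : C → Exponent v) f →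
                 (∀ a b → r (f a b) ≡ p a ⊕ q b) → ∀ as bs →
                 polynomial p as * polynomial q bs ≈ polynomial r (cartesianProductWith f as bs)
  polynomial-* p q r f r≡ []       bs e = *-zeroˡ (polynomial q bs) e
  polynomial-* p q r f r≡ (a ∷ as) bs e = begin
    (polynomial p (a ∷ as) * polynomial q bs) e
      ≡⟨ *-distribʳ-+ (monomial (p a)) (polynomial p as) (polynomial q bs) e ⟩
    (monomial (p a) * polynomial q bs) e ℤ.+ (polynomial p as * polynomial q bs) e
      ≡⟨ cong₂ ℤ._+_ (monomial-*-polynomial (p a) q bs e) (polynomial-* p q r f r≡ as bs e) ⟩
    polynomial (λ b → p a ⊕ q b) bs e ℤ.+ polynomial r cs e
      ≡⟨ cong (ℤ._+ polynomial r cs e) (sum-cong bs λ {b} _ → cong (λ c → monomial c e) (sym (r≡ a b))) ⟩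
    polynomial (r ∘ f a) bs e ℤ.+ polynomial r cs e
      ≡⟨ cong (ℤ._+ polynomial r cs e) (polynomial-map r (f a) bs e) ⟨
    polynomial r (List.map (f a) bs) e ℤ.+ polynomial r cs e
      ≡⟨ polynomial-++ r (List.map (f a) bs) cs e ⟨
    polynomial r (cartesianProductWith f (a ∷ as) bs) e ∎
    where
    open ≡-Reasoning
    cs = cartesianProductWith f as bs

  weight : ∀ {A : Set} {k} → (Fin k → A → Exponent v) → Vec A k → Exponent v
  weight p as = ∑ λ i → p i (lookup as i)

-- Expansion of products of geometric series

choices : ∀ {A : Set} → List A → ∀ k → List (Vec A k)
choices as zero    = [] ∷ []
choices as (suc k) = cartesianProductWith _∷_ as (choices as k)

choices-unique : ∀ {A : Set} {as : List A} → Unique as → ∀ k → Unique (choices as k)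
choices-unique as! zero    = [] ∷ []
choices-unique as! (suc k) = Unique.cartesianProductWith⁺ _∷_ Vec.∷-injective as! (choices-unique as! k)

∈-choices⁺ : ∀ {A : Set} {as : List A} {k} (bs : Vec A k) → (∀ i → lookup bs i ∈ as) → bs ∈ choices as k
∈-choices⁺ []       p = here refl
∈-choices⁺ (b ∷ bs) p = ∈-cartesianProductWith⁺ _∷_ (p Fin.zero) (∈-choices⁺ bs (p ∘ Fin.suc))

module _ {v : ℕ} where

  -- Multiplying out takes one index from each factor, and `choices` lists these selections.
  -- Selecting multiplicities yields rows, and selecting rows yields matrices.
  ∏-polynomial : ∀ {A : Set} {K k as} {f : Fin k → PowerSeries v} {p : Fin k → A → Exponent v} →
                 (∀ i → f i ≈[ K ] polynomial (p i) as) →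
                 ∏ f ≈[ K ] polynomial (weight p) (choices as k)
  ∏-polynomial {k = zero}  p≈ e e≤K = sym (ℤ.+-identityʳ _)
  ∏-polynomial {k = suc k} {as} {p = p} p≈ e e≤K = trans
    (*-cong (p≈ Fin.zero) (∏-polynomial (p≈ ∘ Fin.suc)) e e≤K)
    (polynomial-* (p Fin.zero) (weight (p ∘ Fin.suc)) (weight p) _∷_ (λ _ _ → refl) as (choices as k) e)

  -- The leading `1#` is the zeroth power, and multiplication by `u` raises every other multiplicity
  -- by one.
  geometric-monomial : ∀ {u : PowerSeries v} {a} → u ≈ monomial a → ∀ k →
                       geometric u k ≈ polynomial (_· a) (upTo k)
  geometric-monomial u≈ zero e = refl
  geometric-monomial {u} {a} u≈ (suc k) e = cong (ℤ._+_ (1# e)) (begin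
    (u * geometric u k) e
      ≡⟨ *-cong {K = degree e} (λ b _ → u≈ b) (λ b _ → geometric-monomial u≈ k b) e ℕ.≤-refl ⟩
    (monomial a * polynomial (_· a) (upTo k)) e
      ≡⟨ monomial-*-polynomial a (_· a) (upTo k) e ⟩
    polynomial ((_· a) ∘ suc) (upTo k) e
      ≡⟨ polynomial-map (_· a) suc (upTo k) e ⟨
    polynomial (_· a) (List.map suc (upTo k)) e
      ≡⟨ cong (λ ks → polynomial (_· a) ks e) (List.map-upTo suc k) ⟩
    polynomial (_· a) (applyUpTo suc k) e ∎)
    where open ≡-Reasoning

  -- Each added power `K · a` has degree at least `K`, which exceeds `degree e`, so the coefficient
  -- at `e` does not change.
  powers-stable : ∀ {a : Exponent v} → 1 ≤ degree a → ∀ e {k K} → degree e < k → k ℕ.≤′ K →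
                  polynomial (_· a) (upTo k) e ≡ polynomial (_· a) (upTo K) e
  powers-stable 1≤a e e<k (ℕ.≤′-reflexive refl) = refl
  powers-stable {a} 1≤a e {k} e<k (ℕ.≤′-step {K} k≤K) = begin
    polynomial (_· a) (upTo k) e
      ≡⟨ powers-stable 1≤a e e<k k≤K ⟩
    polynomial (_· a) (upTo K) e
      ≡⟨ ℤ.+-identityʳ _ ⟨
    polynomial (_· a) (upTo K) e ℤ.+ 0ℤ
      ≡⟨ cong (ℤ._+_ (polynomial (_· a) (upTo K) e)) (trans (ℤ.+-identityʳ _) (monomial-≢ e≢K·a)) ⟨
    polynomial (_· a) (upTo K) e ℤ.+ polynomial (_· a) (K ∷ []) e
      ≡⟨ polynomial-++ (_· a) (upTo K) (K ∷ []) e ⟨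
    polynomial (_· a) (upTo K ∷ʳ K) e
      ≡⟨ cong (λ ks → polynomial (_· a) ks e) (List.upTo-∷ʳ K) ⟩
    polynomial (_· a) (upTo (suc K)) e ∎
    where
    open ≡-Reasoning
    e≢K·a : e ≢ K · a
    e≢K·a refl = ℕ.<-irrefl refl (ℕ.<-≤-trans e<k (ℕ.≤-trans (ℕ.≤′⇒≤ k≤K) (degree-· 1≤a K)))

  -- The inverse is cut off at a point depending on `e`. One list of powers that serves all degrees
  -- up to `K` lets the factors be multiplied as finite sums.
  [1-u]⁻¹ : ∀ {u : PowerSeries v} {a} → u ≈ monomial a → 1 ≤ degree a → ∀ {K} →
            (1# - u) ⁻¹ ≈[ K ] polynomial (_· a) (upTo (suc K))
  [1-u]⁻¹ {u} {a} u≈ 1≤a e e≤K = trans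
    (geometric-monomial (λ b → trans (double-negation (1# b) (u b)) (u≈ b)) (suc (degree e)) e)
    (powers-stable 1≤a e ℕ.≤-refl (ℕ.≤⇒≤′ (s≤s e≤K)))
    where
    double-negation : ∀ p q → p ℤ.- (p ℤ.- q) ≡ q
    double-negation = solve-∀

-- Last passage percolation

antitone⇒≤₀ : ∀ {f : ℕ → ℕ} → (∀ j → f (suc j) ≤ f j) → ∀ j → f j ≤ f 0
antitone⇒≤₀ f↘ zero    = ℕ.≤-refl
antitone⇒≤₀ f↘ (suc j) = ℕ.≤-trans (f↘ j) (antitone⇒≤₀ f↘ j)

-- Conjugacy speaks of strict inequalities only, so numbers are compared through their sets of
-- predecessors.
<-⊆⇒≤ : ∀ {a b} → (∀ {k} → k < a → k < b) → a ≤ b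
<-⊆⇒≤ p = ℕ.≮⇒≥ λ b<a → ℕ.<-irrefl refl (p b<a)

-- Conjugation of partitions: the diagrams of `f` and `g` are transposes of each other. It relates a
-- row of a plane partition to its column counts.
Conjugate : (ℕ → ℕ) → (ℕ → ℕ) → Set
Conjugate f g = ∀ ℓ j → ℓ < f j ⇔ j < g ℓ

conjugate : ℕ → (ℕ → ℕ) → ℕ → ℕ
conjugate zero    f j = 0
conjugate (suc b) f j with j ℕ.<? f 0
... | yes _ = suc (conjugate b (f ∘ suc) j)
... | no  _ = 0

conjugate⇒ : ∀ b f ℓ j → ℓ < conjugate b f j → j < f ℓ
conjugate⇒ (suc b) f ℓ j ℓ< with j ℕ.<? f 0
conjugate⇒ (suc b) f zero    j ℓ<       | yes j<f₀ = j<f₀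
conjugate⇒ (suc b) f (suc ℓ) j (s≤s ℓ<) | yes _    = conjugate⇒ b (f ∘ suc) ℓ j ℓ<

-- `conjugate` stops counting at the first `ℓ` with `f ℓ ≤ j`, or after `b` steps. Antitonicity
-- excludes later hits in the first case, the vanishing of `f` from `b` on in the second.
conjugate⇐ : ∀ b f → (∀ ℓ → f (suc ℓ) ≤ f ℓ) → (∀ ℓ → b ≤ ℓ → f ℓ ≡ 0) →
             ∀ ℓ j → j < f ℓ → ℓ < conjugate b f j
conjugate⇐ zero    f f↘ f₀ ℓ j j<f = contradiction (subst (j <_) (f₀ ℓ z≤n) j<f) ℕ.n≮0
conjugate⇐ (suc b) f f↘ f₀ ℓ j j<f with j ℕ.<? f 0
conjugate⇐ (suc b) f f↘ f₀ zero    j j<f | yes _ = s≤s z≤n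
conjugate⇐ (suc b) f f↘ f₀ (suc ℓ) j j<f | yes _ =
  s≤s (conjugate⇐ b (f ∘ suc) (f↘ ∘ suc) (λ k b≤k → f₀ (suc k) (s≤s b≤k)) ℓ j j<f)
conjugate⇐ (suc b) f f↘ f₀ ℓ j j<f | no j≮f₀ =
  contradiction (ℕ.<-≤-trans j<f (antitone⇒≤₀ f↘ ℓ)) j≮f₀

conjugate-Conjugate : ∀ {b f} → (∀ ℓ → f (suc ℓ) ≤ f ℓ) → (∀ ℓ → b ≤ ℓ → f ℓ ≡ 0) →
                      Conjugate (conjugate b f) f
conjugate-Conjugate {b} {f} f↘ f₀ ℓ j = mk⇔ (conjugate⇒ b f ℓ j) (conjugate⇐ b f f↘ f₀ ℓ j)

-- lastPassage D i ℓ is the maximal weight of a path from (i , ℓ) with steps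
-- (+1 , 0) and (0 , +1) through D, extended by 0.

-- `h` holds the passage values of the next row. The value 0 past the right end starts the
-- recursion, which runs from right to left.
lastPassageRow : ∀ {m} → Vec ℕ m → (ℕ → ℕ) → ℕ → ℕ
lastPassageRow []       h ℓ       = 0
lastPassageRow (d ∷ ds) h zero    = d ℕ.+ (lastPassageRow ds (h ∘ suc) 0 ⊔ h 0)
lastPassageRow (d ∷ ds) h (suc ℓ) = lastPassageRow ds (h ∘ suc) ℓ

lastPassageRow-step : ∀ {m} (ds : Vec ℕ m) h ℓ → lastPassageRow ds h (toℕ ℓ) ≡
                      lookup ds ℓ ℕ.+ (lastPassageRow ds h (suc (toℕ ℓ)) ⊔ h (toℕ ℓ))
lastPassageRow-step (d ∷ ds) h Fin.zero    = refl
lastPassageRow-step (d ∷ ds) h (Fin.suc ℓ) = lastPassageRow-step ds (h ∘ suc) ℓ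

lastPassageRow-vanish : ∀ {m} (ds : Vec ℕ m) h ℓ → m ≤ ℓ → lastPassageRow ds h ℓ ≡ 0
lastPassageRow-vanish []       h ℓ       m≤ℓ       = refl
lastPassageRow-vanish (d ∷ ds) h (suc ℓ) (s≤s m≤ℓ) = lastPassageRow-vanish ds (h ∘ suc) ℓ m≤ℓ

lastPassageRow-antitone : ∀ {m} (ds : Vec ℕ m) h ℓ → lastPassageRow ds h (suc ℓ) ≤ lastPassageRow ds h ℓ
lastPassageRow-antitone []       h ℓ       = z≤n
lastPassageRow-antitone (d ∷ ds) h zero    = ℕ.≤-trans (ℕ.m≤m⊔n _ (h 0)) (ℕ.m≤n+m _ d)
lastPassageRow-antitone (d ∷ ds) h (suc ℓ) = lastPassageRow-antitone ds (h ∘ suc) ℓ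

lastPassageRow-above : ∀ {m} (ds : Vec ℕ m) h → (∀ ℓ → m ≤ ℓ → h ℓ ≡ 0) → ∀ ℓ → h ℓ ≤ lastPassageRow ds h ℓ
lastPassageRow-above []       h h₀ ℓ       = ℕ.≤-reflexive (h₀ ℓ z≤n)
lastPassageRow-above (d ∷ ds) h h₀ zero    = ℕ.≤-trans (ℕ.m≤n⊔m _ (h 0)) (ℕ.m≤n+m _ d)
lastPassageRow-above (d ∷ ds) h h₀ (suc ℓ) =
  lastPassageRow-above ds (h ∘ suc) (λ k m≤k → h₀ (suc k) (s≤s m≤k)) ℓ

-- Solving the recursion for the matrix entry gives a difference. Truncated subtraction is exact
-- there because `g` dominates both its right neighbour and `h`.
lastPassageRow-surjective : ∀ m (g h : ℕ → ℕ) → (∀ ℓ → g (suc ℓ) ≤ g ℓ) → (∀ ℓ → h ℓ ≤ g ℓ) →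
                            (∀ ℓ → m ≤ ℓ → g ℓ ≡ 0) →
                            ∃ λ (ds : Vec ℕ m) → ∀ ℓ → lastPassageRow ds h ℓ ≡ g ℓ
lastPassageRow-surjective zero    g h g↘ h≤g g₀ = [] , λ ℓ → sym (g₀ ℓ z≤n)
lastPassageRow-surjective (suc m) g h g↘ h≤g g₀
  with lastPassageRow-surjective m (g ∘ suc) (h ∘ suc) (g↘ ∘ suc) (h≤g ∘ suc) (λ ℓ m≤ℓ → g₀ (suc ℓ) (s≤s m≤ℓ))
... | ds , ds≡ = g 0 ∸ (g 1 ⊔ h 0) ∷ ds , λ where
  zero    → trans (cong (λ k → g 0 ∸ (g 1 ⊔ h 0) ℕ.+ (k ⊔ h 0)) (ds≡ 0))
                  (ℕ.m∸n+n≡m (ℕ.⊔-lub (g↘ 0) (h≤g 0)))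
  (suc ℓ) → ds≡ ℓ

lastPassage : ∀ {n m} → Vec (Vec ℕ m) n → ℕ → ℕ → ℕ
lastPassage []       i       = λ _ → 0
lastPassage (ds ∷ D) zero    = lastPassageRow ds (lastPassage D 0)
lastPassage (ds ∷ D) (suc i) = lastPassage D i

module _ {m : ℕ} where

  lastPassage-step : ∀ {n} (D : Vec (Vec ℕ m) n) i ℓ → lastPassage D (toℕ i) (toℕ ℓ) ≡
                     lookup (lookup D i) ℓ ℕ.+
                     (lastPassage D (toℕ i) (suc (toℕ ℓ)) ⊔ lastPassage D (suc (toℕ i)) (toℕ ℓ))
  lastPassage-step (ds ∷ D) Fin.zero    = lastPassageRow-step ds (lastPassage D 0)
  lastPassage-step (ds ∷ D) (Fin.suc i) = lastPassage-step D i

  lastPassage-vanish-row : ∀ {n} (D : Vec (Vec ℕ m) n) i ℓ → n ≤ i → lastPassage D i ℓ ≡ 0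
  lastPassage-vanish-row []       i       ℓ n≤i       = refl
  lastPassage-vanish-row (ds ∷ D) (suc i) ℓ (s≤s n≤i) = lastPassage-vanish-row D i ℓ n≤i

  lastPassage-vanish-column : ∀ {n} (D : Vec (Vec ℕ m) n) i ℓ → m ≤ ℓ → lastPassage D i ℓ ≡ 0
  lastPassage-vanish-column []       i       ℓ m≤ℓ = refl
  lastPassage-vanish-column (ds ∷ D) zero    ℓ m≤ℓ = lastPassageRow-vanish ds (lastPassage D 0) ℓ m≤ℓ
  lastPassage-vanish-column (ds ∷ D) (suc i) ℓ m≤ℓ = lastPassage-vanish-column D i ℓ m≤ℓ

  lastPassage-row-antitone : ∀ {n} (D : Vec (Vec ℕ m) n) i ℓ → lastPassage D i (suc ℓ) ≤ lastPassage D i ℓ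
  lastPassage-row-antitone []       i       ℓ = z≤n
  lastPassage-row-antitone (ds ∷ D) zero    ℓ = lastPassageRow-antitone ds (lastPassage D 0) ℓ
  lastPassage-row-antitone (ds ∷ D) (suc i) ℓ = lastPassage-row-antitone D i ℓ

  lastPassage-column-antitone : ∀ {n} (D : Vec (Vec ℕ m) n) ℓ i → lastPassage D (suc i) ℓ ≤ lastPassage D i ℓ
  lastPassage-column-antitone []       ℓ i       = z≤n
  lastPassage-column-antitone (ds ∷ D) ℓ zero    =
    lastPassageRow-above ds (lastPassage D 0) (lastPassage-vanish-column D 0) ℓ
  lastPassage-column-antitone (ds ∷ D) ℓ (suc i) = lastPassage-column-antitone D ℓ i

  -- In the recursion an entry is added to a maximum of two passage values; cancelling this maximum
  -- recovers the entry.
  lastPassage-injective : ∀ {n} {D E : Vec (Vec ℕ m) n} →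
                          (∀ i ℓ → lastPassage D i ℓ ≡ lastPassage E i ℓ) → D ≡ E
  lastPassage-injective {D = D} {E} D≡E = lookup-extensional λ i → lookup-extensional λ ℓ →
    ℕ.+-cancelʳ-≡ _ _ _ (begin
      lookup (lookup D i) ℓ ℕ.+
        (lastPassage D (toℕ i) (suc (toℕ ℓ)) ⊔ lastPassage D (suc (toℕ i)) (toℕ ℓ))
        ≡⟨ lastPassage-step D i ℓ ⟨
      lastPassage D (toℕ i) (toℕ ℓ)
        ≡⟨ D≡E (toℕ i) (toℕ ℓ) ⟩
      lastPassage E (toℕ i) (toℕ ℓ)
        ≡⟨ lastPassage-step E i ℓ ⟩
      lookup (lookup E i) ℓ ℕ.+
        (lastPassage E (toℕ i) (suc (toℕ ℓ)) ⊔ lastPassage E (suc (toℕ i)) (toℕ ℓ))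
        ≡⟨ cong (lookup (lookup E i) ℓ ℕ.+_) (cong₂ _⊔_ (D≡E (toℕ i) _) (D≡E (suc (toℕ i)) _)) ⟨
      lookup (lookup E i) ℓ ℕ.+
        (lastPassage D (toℕ i) (suc (toℕ ℓ)) ⊔ lastPassage D (suc (toℕ i)) (toℕ ℓ)) ∎)
    where
    open ≡-Reasoning
    lookup-extensional : ∀ {A : Set} {k} {as bs : Vec A k} → (∀ i → lookup as i ≡ lookup bs i) → as ≡ bs
    lookup-extensional {as = as} {bs} p =
      trans (sym (Vec.tabulate∘lookup as)) (trans (Vec.tabulate-cong p) (Vec.tabulate∘lookup bs))

  -- Rows are solved from the last one upwards, each against the passage values of the row after it.
  lastPassage-surjective : ∀ n (H : ℕ → ℕ → ℕ) →
                           (∀ i ℓ → H i (suc ℓ) ≤ H i ℓ) → (∀ ℓ i → H (suc i) ℓ ≤ H i ℓ) →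
                           (∀ i ℓ → n ≤ i → H i ℓ ≡ 0) → (∀ i ℓ → m ≤ ℓ → H i ℓ ≡ 0) →
                           ∃ λ (D : Vec (Vec ℕ m) n) → ∀ i ℓ → lastPassage D i ℓ ≡ H i ℓ
  lastPassage-surjective zero    H row↘ col↘ row₀ col₀ = [] , λ i ℓ → sym (row₀ i ℓ z≤n)
  lastPassage-surjective (suc n) H row↘ col↘ row₀ col₀
    with lastPassage-surjective n (H ∘ suc) (row↘ ∘ suc) (λ ℓ → col↘ ℓ ∘ suc)
           (λ i ℓ n≤i → row₀ (suc i) ℓ (s≤s n≤i)) (col₀ ∘ suc)
  ... | D , D≡
    with lastPassageRow-surjective m (H 0) (lastPassage D 0) (row↘ 0)
           (λ ℓ → ℕ.≤-trans (ℕ.≤-reflexive (D≡ 0 ℓ)) (col↘ ℓ 0)) (col₀ 0)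
  ... | ds , ds≡ = ds ∷ D , λ where
    zero    → ds≡
    (suc i) → D≡ i

-- Plane partitions

module _ {n m : ℕ} where

  open Equivalence using (to; from)

  Matrix : Set
  Matrix = Vec (Vec ℕ m) n

  -- A relation rather than a function, so that one computation of weights covers both an arbitrary
  -- `π` and the one built from a matrix.
  record Encodes (D : Matrix) (π : PP∞ n m) : Set where
    constructor encodes
    field conjugacy : ∀ i → Conjugate (PP∞.entry π i) (lastPassage D i)

  fromMatrix : Matrix → PP∞ n m
  fromMatrix D = record
    { planePartition = record
      { entry       = entry
      ; column-decr = λ i j → <-⊆⇒≤ λ {ℓ} ℓ< →
          from (conj i ℓ j) (ℕ.<-≤-trans (to (conj (suc i) ℓ j) ℓ<) (lastPassage-column-antitone D ℓ i))
      ; row-decr    = λ i j → <-⊆⇒≤ λ {ℓ} ℓ< →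
          from (conj i ℓ j) (ℕ.<-trans (ℕ.n<1+n j) (to (conj i ℓ (suc j)) ℓ<))
      -- By conjugacy row 0 has `lastPassage D 0 0` nonzero entries, and no later row has more.
      ; bound       = n ⊔ lastPassage D 0 0
      ; outside     = λ where
          i j (inj₁ b≤i) → vanish i j (λ ℓ → lastPassage-vanish-row D i ℓ (ℕ.m⊔n≤o⇒m≤o n _ b≤i))
          i j (inj₂ b≤j) → ℕ.n≤0⇒n≡0 (ℕ.≮⇒≥ λ 0< → ℕ.<-irrefl refl (begin-strict
            j                 <⟨ to (conj i 0 j) 0< ⟩
            lastPassage D i 0 ≤⟨ antitone⇒≤₀ (lastPassage-column-antitone D 0) i ⟩
            lastPassage D 0 0 ≤⟨ ℕ.m⊔n≤o⇒n≤o n _ b≤j ⟩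
            j                 ∎))
      }
    ; rows≤    = λ i j n≤i → vanish i j (λ ℓ → lastPassage-vanish-row D i ℓ n≤i)
    ; entries≤ = λ i j → <-⊆⇒≤ λ {ℓ} ℓ< → ℕ.≰⇒> λ m≤ℓ →
        ℕ.n≮0 (subst (j <_) (lastPassage-vanish-column D i ℓ m≤ℓ) (to (conj i ℓ j) ℓ<))
    }
    where
    open ℕ.≤-Reasoning
    entry : ℕ → ℕ → ℕ
    entry i = conjugate m (lastPassage D i)

    conj : ∀ i → Conjugate (entry i) (lastPassage D i)
    conj i = conjugate-Conjugate (lastPassage-row-antitone D i) (lastPassage-vanish-column D i)

    vanish : ∀ i j → (∀ ℓ → lastPassage D i ℓ ≡ 0) → entry i j ≡ 0
    vanish i j p = ℕ.n≤0⇒n≡0 (ℕ.≮⇒≥ λ 0< → ℕ.n≮0 (subst (j <_) (p 0) (to (conj i 0 j) 0<)))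

  fromMatrix-encodes : ∀ D → Encodes D (fromMatrix D)
  fromMatrix-encodes D = encodes λ i →
    conjugate-Conjugate (lastPassage-row-antitone D i) (lastPassage-vanish-column D i)

  -- The column counts `H` decrease in `ℓ` by their meaning and in `i` because the columns of `π`
  -- decrease; they vanish outside `n` rows and `m` values. Hence they are the passage values of
  -- some matrix.
  toMatrix : ∀ π → ∃ λ D → Encodes D π
  toMatrix π = proj₁ D , encodes λ i ℓ j → mk⇔
    (λ ℓ< → subst (j <_) (sym (proj₂ D i ℓ)) (from (conj i j ℓ) ℓ<))
    (λ j< → to (conj i j ℓ) (subst (j <_) (proj₂ D i ℓ) j<))
    where
    open PP∞ π
    H : ℕ → ℕ → ℕ
    H i = conjugate bound (entry i)

    conj : ∀ i → Conjugate (H i) (entry i)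
    conj i = conjugate-Conjugate (row-decr i) (λ j b≤j → outside i j (inj₂ b≤j))

    vanish : ∀ i ℓ → (∀ j → entry i j ≤ ℓ) → H i ℓ ≡ 0
    vanish i ℓ p = ℕ.n≤0⇒n≡0 (ℕ.≮⇒≥ λ 0< → ℕ.<⇒≱ (to (conj i 0 ℓ) 0<) (p 0))

    D : ∃ λ D → ∀ i ℓ → lastPassage D i ℓ ≡ H i ℓ
    D = lastPassage-surjective n H
      (λ i ℓ → <-⊆⇒≤ λ {j} j< →
        from (conj i j ℓ) (ℕ.<-trans (ℕ.n<1+n ℓ) (to (conj i j (suc ℓ)) j<)))
      (λ ℓ i → <-⊆⇒≤ λ {j} j< →
        from (conj i j ℓ) (ℕ.<-≤-trans (to (conj (suc i) j ℓ) j<) (column-decr i j)))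
      (λ i ℓ n≤i → vanish i ℓ λ j → ℕ.≤-trans (ℕ.≤-reflexive (rows≤ i j n≤i)) z≤n)
      (λ i ℓ m≤ℓ → vanish i ℓ λ j → ℕ.≤-trans (entries≤ i j) m≤ℓ)

  open Setoid (PP∞-setoid n m) using () renaming (_≈_ to _≈ₚ_)

  Encodes-functional : ∀ {D π ρ} → Encodes D π → Encodes D ρ → π ≈ₚ ρ
  Encodes-functional (encodes Dπ) (encodes Dρ) i j = ℕ.≤-antisym
    (<-⊆⇒≤ λ {ℓ} ℓ< → from (Dρ i ℓ j) (to (Dπ i ℓ j) ℓ<))
    (<-⊆⇒≤ λ {ℓ} ℓ< → from (Dπ i ℓ j) (to (Dρ i ℓ j) ℓ<))

  -- Conjugacy recovers the passage values from the entries of the plane partition, and these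
  -- determine the matrix.
  Encodes-injective : ∀ {D E π ρ} → Encodes D π → Encodes E ρ → π ≈ₚ ρ → D ≡ E
  Encodes-injective (encodes Dπ) (encodes Eρ) π≈ρ = lastPassage-injective λ i ℓ → ℕ.≤-antisym
    (<-⊆⇒≤ λ {j} j< → to (Eρ i ℓ j) (subst (ℓ <_) (π≈ρ i j) (from (Dπ i ℓ j) j<)))
    (<-⊆⇒≤ λ {j} j< → to (Dπ i ℓ j) (subst (ℓ <_) (sym (π≈ρ i j)) (from (Eρ i ℓ j) j<)))

-- Descents

-- With boolean tests, shifting `j`, `p` and `q` together by one preserves the value by computation,
-- which drives the induction in `∑-interval`. For `q ≤ p` the interval is empty, in accordance with
-- `q ∸ p`.
interval : ∀ {v} → ℕ → ℕ → Exponent v → ℕ → Exponent v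
interval p q a j = if does (j ℕ.<? p) then 𝟘 else if does (j ℕ.<? q) then a else 𝟘

interval-∈ : ∀ {v p q j} {a : Exponent v} → ¬ (j < p) → j < q → interval p q a j ≡ a
interval-∈ {p = p} {q} {j} j≮p j<q rewrite dec-false (j ℕ.<? p) j≮p | dec-true (j ℕ.<? q) j<q = refl

interval-∉ : ∀ {v p q j} {a : Exponent v} → (j < q → j < p) → interval p q a j ≡ 𝟘
interval-∉ {p = p} {q} {j} j<q⇒j<p with j ℕ.<? p | j ℕ.<? q
... | yes j<p | _       rewrite dec-true (j ℕ.<? p) j<p = refl
... | no  j≮p | yes j<q = contradiction (j<q⇒j<p j<q) j≮p
... | no  j≮p | no  j≮q rewrite dec-false (j ℕ.<? p) j≮p | dec-false (j ℕ.<? q) j≮q = refl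

∑-interval : ∀ {v} b p q (a : Exponent v) → q ≤ b → ∑ {n = b} (λ j → interval p q a (toℕ j)) ≡ (q ∸ p) · a
∑-interval b       p       zero    a q≤b rewrite ℕ.0∸n≡0 p =
  ∑-zero {t = λ (j : Fin b) → interval p 0 a (toℕ j)} λ j → interval-∉ {p = p} {0} {toℕ j} {a} λ ()
∑-interval (suc b) zero    (suc q) a (s≤s q≤b) = cong (a ⊕_) (∑-interval b 0 q a q≤b)
∑-interval (suc b) (suc p) (suc q) a (s≤s q≤b) = trans (⊕-identityˡ _) (∑-interval b p q a q≤b)

-- Entries of `π` are 1-based subscripts of `z` while `Fin` counts from 0; this is the source of
-- `ℓ + 1` in the description of descents.
toℕ-subscript : ∀ {m k b} (b<k : b < k) (k≤m : k ≤ m) → suc (toℕ (subscript b<k k≤m)) ≡ k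
toℕ-subscript {k = suc _} _ k≤m = cong suc (Fin.toℕ-fromℕ< k≤m)

module _ {n m : ℕ} where

  open Equivalence using (to; from)

  cell : Fin n → Fin m → Exponent (n ℕ.+ m)
  cell i ℓ = (𝟘 [ i ↑ˡ m ]≔ 1) ⊕ (𝟘 [ n ↑ʳ ℓ ]≔ 1)

  x*z : ∀ i ℓ → x {n} {m} i * z {n} {m} ℓ ≈ monomial (cell i ℓ)
  x*z i ℓ = monomial-* (𝟘 [ i ↑ˡ m ]≔ 1) (𝟘 [ n ↑ʳ ℓ ]≔ 1)

  degree-cell : ∀ i ℓ → 1 ≤ degree (cell i ℓ)
  degree-cell i ℓ = ℕ.≤-trans (degree-unit (i ↑ˡ m)) (degree-⊕ˡ (𝟘 [ i ↑ˡ m ]≔ 1) _)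

  rowWeight : Fin n → Vec ℕ m → Exponent (n ℕ.+ m)
  rowWeight i = weight λ ℓ k → k · cell i ℓ

  matrixWeight : Matrix {n} {m} → Exponent (n ℕ.+ m)
  matrixWeight = weight rowWeight

  module _ {D : Matrix {n} {m}} {π : PP∞ n m} (D~π : Encodes D π) where
    open PP∞ π
    open Encodes D~π

    G : ℕ → ℕ → ℕ
    G = lastPassage D

    lower : Fin n → Fin m → ℕ
    lower i ℓ = G (toℕ i) (suc (toℕ ℓ)) ⊔ G (suc (toℕ i)) (toℕ ℓ)

    -- The descents (i , j) with π i j = ℓ + 1 fill the columns from lower i ℓ to G i ℓ.
    share : Fin n → ℕ → Fin m → Exponent (n ℕ.+ m)
    share i j ℓ = interval (lower i ℓ) (G (toℕ i) (toℕ ℓ)) (cell i ℓ) j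

    -- The entry is exactly `ℓ + 1`, so `j` is below `G i ℓ` but not below `G i (ℓ + 1)`. Being a
    -- descent, it has an entry at most `ℓ` underneath, so `j` is not below `G (i + 1) ℓ` either.
    column∈share : ∀ i j ℓ → suc (toℕ ℓ) ≡ entry (toℕ i) j → Des (toℕ i , j) → share i j ℓ ≡ cell i ℓ
    column∈share i j ℓ ℓ+1≡ d = interval-∈ {p = lower i ℓ}
      (λ j<lower → ℕ.<⇒≱ j<lower (ℕ.⊔-lub
        (ℕ.≮⇒≥ λ j< → ℕ.<-irrefl ℓ+1≡ (from (conjugacy (toℕ i) _ j) j<))
        (ℕ.≮⇒≥ λ j< → ℕ.<⇒≱ (from (conjugacy (suc (toℕ i)) _ j) j<)
          (ℕ.s≤s⁻¹ (ℕ.≤-trans d (ℕ.≤-reflexive (sym ℓ+1≡)))))))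
      (to (conjugacy (toℕ i) _ j) (ℕ.≤-reflexive ℓ+1≡))

    -- If `ℓ < π i j` fails, `j` lies past the upper end `G i ℓ`; otherwise either alternative puts
    -- it before `lower i ℓ`.
    column∉share : ∀ i j ℓ → (toℕ ℓ < entry (toℕ i) j →
                   suc (toℕ ℓ) < entry (toℕ i) j ⊎ toℕ ℓ < entry (suc (toℕ i)) j) → share i j ℓ ≡ 𝟘
    column∉share i j ℓ p = interval-∉ {p = lower i ℓ} λ j< → below-lower (p (from (conjugacy (toℕ i) _ j) j<))
      where
      below-lower : suc (toℕ ℓ) < entry (toℕ i) j ⊎ toℕ ℓ < entry (suc (toℕ i)) j → j < lower i ℓ
      below-lower (inj₁ ℓ+1<) = ℕ.m<n⇒m<n⊔o _ (to (conjugacy (toℕ i) _ j) ℓ+1<)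
      below-lower (inj₂ ℓ<)   = ℕ.m<n⇒m<o⊔n _ (to (conjugacy (suc (toℕ i)) _ j) ℓ<)

    -- A descent lies in the interval of exactly one `ℓ`, the one given by its entry; a column
    -- without a descent lies in none.
    factor-share : ∀ i j d? → factor π i j d? ≈ monomial (∑ (share i j))
    factor-share i j (yes d) e = trans (x*z i k e) (cong (λ a → monomial a e) (sym (trans
      (∑-single k λ ℓ ℓ≢k → column∉share i j ℓ λ ℓ< →
        -- Equality of `ℓ + 1` with the entry, which is `k + 1`, would force `ℓ` to be `k`.
        inj₁ (ℕ.≤∧≢⇒< ℓ< λ ℓ+1≡ → ℓ≢k (Fin.toℕ-injective (ℕ.suc-injective (trans ℓ+1≡ (sym k+1≡))))))
      (column∈share i j k k+1≡ d))))
      where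
      k = subscript d (entries≤ (toℕ i) j)
      k+1≡ = toℕ-subscript d (entries≤ (toℕ i) j)
    factor-share i j (no ¬d) e = cong (λ a → monomial a e) (sym (∑-zero λ ℓ →
      column∉share i j ℓ λ ℓ< → inj₂ (ℕ.<-≤-trans ℓ< (ℕ.≮⇒≥ ¬d))))

    -- After exchanging the sums over columns and values, each `ℓ` contributes the length of its
    -- interval. By the last passage recursion this length is the matrix entry.
    row-share : ∀ i → ∑ {n = bound} (λ j → ∑ (share i (toℕ j))) ≡ rowWeight i (lookup D i)
    row-share i = trans (∑-comm {m = bound} (λ j → share i (toℕ j))) (∑-cong λ ℓ → trans
      -- The interval fits into the first `bound` columns, since the entry in column `bound` is 0.
      (∑-interval bound (lower i ℓ) (G (toℕ i) (toℕ ℓ)) (cell i ℓ) (ℕ.≮⇒≥ λ b< →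
        ℕ.n≮0 (subst (toℕ ℓ <_) (outside (toℕ i) bound (inj₂ ℕ.≤-refl)) (from (conjugacy (toℕ i) _ bound) b<))))
      (cong (_· cell i ℓ) (trans (cong (_∸ lower i ℓ) (lastPassage-step D i ℓ)) (ℕ.m+n∸n≡m _ (lower i ℓ)))))

    descentProduct-monomial : descentProduct π ≈ monomial (matrixWeight D)
    descentProduct-monomial e = trans
      (∏-monomial (λ i → ∏-monomial {k = bound} (λ j → factor-share i (toℕ j) (Des? (toℕ i) (toℕ j)))) e)
      (cong (λ a → monomial a e) (∑-cong row-share))

  -- The product side as a sum over matrices

  matrices : ℕ → List (Matrix {n} {m})
  matrices K = choices (choices (upTo (suc K)) m) n

  matrices-unique : ∀ K → Unique (matrices K)
  matrices-unique K = choices-unique (choices-unique (Unique.upTo⁺ (suc K)) m) n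

  -- Every cell has positive degree, so no entry of `D` exceeds the degree of its weight.
  ∈-matrices : ∀ D → D ∈ matrices (degree (matrixWeight D))
  ∈-matrices D = ∈-choices⁺ D λ i → ∈-choices⁺ (lookup D i) λ ℓ → ∈-upTo⁺ (s≤s (begin
    lookup (lookup D i) ℓ
      ≤⟨ degree-· (degree-cell i ℓ) (lookup (lookup D i) ℓ) ⟩
    degree (lookup (lookup D i) ℓ · cell i ℓ)
      ≤⟨ degree-∑ (λ ℓ → lookup (lookup D i) ℓ · cell i ℓ) ℓ ⟩
    degree (rowWeight i (lookup D i))
      ≤⟨ degree-∑ (λ i → rowWeight i (lookup D i)) i ⟩
    degree (matrixWeight D) ∎))
    where open ℕ.≤-Reasoning

  ∏[1-xz]⁻¹ : ∀ K → (∏ λ (i : Fin n) → ∏ λ (ℓ : Fin m) → (1# - x {n} {m} i * z {n} {m} ℓ) ⁻¹)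
                    ≈[ K ] polynomial matrixWeight (matrices K)
  ∏[1-xz]⁻¹ K = ∏-polynomial λ i → ∏-polynomial λ ℓ → [1-u]⁻¹ (x*z i ℓ) (degree-cell i ℓ)

theorem4p1 : ∀ (n m : ℕ) → n ≥ 1 → m ≥ 1 →
    HasSum (PP∞-setoid n m) descentProduct
    (∏ λ (i : Fin n) → ∏ λ (ℓ : Fin m) → (1# - x {n} {m} i * z {n} {m} ℓ) ⁻¹)
theorem4p1 n m _ _ e = List.map fromMatrix Ds , unique , complete , total
  where
  -- A matrix of weight `e` has entries at most `degree e`, so this cutoff loses nothing at `e`.
  K = degree e
  Ds = matrices {n} {m} K
  PP = PP∞-setoid n m

  unique = SetoidUnique.map⁺ (setoid Matrix) PP
    (λ {D} {E} → Encodes-injective (fromMatrix-encodes D) (fromMatrix-encodes E))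
    (matrices-unique K)

  complete : ∀ π → descentProduct π e ≢ 0ℤ → [ PP ] π ∈ List.map fromMatrix Ds
  complete π ≢0 with toMatrix π
  -- The list holds `fromMatrix D`, which agrees with `π` entrywise since both are encoded by `D`.
  ... | D , D~π = SetoidMembership.∈-resp-≈ PP
    {x = fromMatrix D} {π} (Encodes-functional (fromMatrix-encodes D) D~π)
    (SetoidMembership.∈-map⁺ (setoid Matrix) PP (λ where refl _ _ → refl) D∈)
    where
    -- A descent product is a single monomial, so a nonzero coefficient identifies its exponent.
    e≡ : e ≡ matrixWeight D
    e≡ = monomial-support (≢0 ∘ trans (descentProduct-monomial D~π e))

    D∈ : D ∈ Ds
    D∈ = subst (λ a → D ∈ matrices (degree a)) (sym e≡) (∈-matrices D)

  total = begin
    sumℤ (List.map (λ π → descentProduct π e) (List.map fromMatrix Ds))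
      ≡⟨ cong sumℤ (List.map-∘ Ds) ⟨
    sumℤ (List.map (λ D → descentProduct (fromMatrix D) e) Ds)
      ≡⟨ sum-cong Ds (λ {D} _ → descentProduct-monomial (fromMatrix-encodes D) e) ⟩
    polynomial matrixWeight Ds e
      ≡⟨ ∏[1-xz]⁻¹ {n} {m} K e ℕ.≤-refl ⟨
    (∏ λ (i : Fin n) → ∏ λ (ℓ : Fin m) → (1# - x {n} {m} i * z {n} {m} ℓ) ⁻¹) e ∎
    where open ≡-Reasoning
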